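{- For each $p>0$, there exists a $\Sigma^0_p$ equivalence relation $E$ on $\omega$ which is complete under finitary reducibility among $\Sigma^0_p$ equivalence relations on $\omega$ (every $\Sigma^0_p$ equivalence relation $F$ satisfies $F\leq_c^{<\omega}E$), but is not complete among them under computable reducibility.
   Context: An equivalence relation on $\omega$ is $\Sigma^0_p$ if it is a $\Sigma^0_p$ subset of $\omega^2$. $F\leq_c E$ means there is a computable total $g$ with $x\,F\,y\iff g(x)\,E\,g(y)$. An $n$-ary reduction from $F$ to $E$ is a computable total $f:\omega\times\omega^n\to\omega$ such that for all $\vec x\in\omega^n$, with $y_i=f(i,\vec x)$, $x_i\,F\,x_j\iff y_i\,E\,y_j$ for all $i<j<n$; $F\leq_c^{<\omega}E$ means there is one computable $f(n,i,\vec x)$ which for each $n$ is an $n$-ary reduction. -}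

module Defs where

open import Level using (0ℓ; Lift)
open import Data.Nat using (ℕ; zero; suc; _+_; _*_; _∸_; _^_; _<_)
open import Data.Fin as Fin using (Fin; toℕ)
open import Data.Vec using (Vec; []; _∷_; lookup; head; tail)
open import Data.Product using (Σ; _×_; _,_)
open import Function.Bundles using (_⇔_)

data PR : ℕ → Set where
  zer  : ∀ {n} → PR n
  succ : PR 1
  proj : ∀ {n} → Fin n → PR n
  comp : ∀ {m n} → PR m → Vec (PR n) m → PR n
  prec : ∀ {n} → PR n → PR (suc (suc n)) → PR (suc n)
  mu   : ∀ {n} → PR (suc n) → PR n

mutual
  data Eval : ∀ {n} → PR n → Vec ℕ n → ℕ → Set where
    e-zer  : ∀ {n} {xs : Vec ℕ n} → Eval zer xs 0
    e-succ : ∀ {x} → Eval succ (x ∷ []) (suc x)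
    e-proj : ∀ {n} {i : Fin n} {xs} → Eval (proj i) xs (lookup xs i)
    e-comp : ∀ {m n} {f : PR m} {gs : Vec (PR n) m} {xs ys y} →
             Evals gs xs ys → Eval f ys y → Eval (comp f gs) xs y
    e-prec0 : ∀ {n} {g : PR n} {h} {xs y} →
              Eval g xs y → Eval (prec g h) (0 ∷ xs) y
    e-precS : ∀ {n} {g : PR n} {h} {k xs z y} →
              Eval (prec g h) (k ∷ xs) z → Eval h (k ∷ z ∷ xs) y →
              Eval (prec g h) (suc k ∷ xs) y
    e-mu   : ∀ {n} {f : PR (suc n)} {xs y} →
             Eval f (y ∷ xs) 0 →
             (∀ z → z < y → Σ ℕ λ k → Eval f (z ∷ xs) (suc k)) →
             Eval (mu f) xs y

  data Evals : ∀ {m n} → Vec (PR n) m → Vec ℕ n → Vec ℕ m → Set where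
    es-[] : ∀ {n} {xs : Vec ℕ n} → Evals [] xs []
    es-∷  : ∀ {m n} {g : PR n} {gs : Vec (PR n) m} {xs y ys} →
            Eval g xs y → Evals gs xs ys → Evals (g ∷ gs) xs (y ∷ ys)

Computable : (m : ℕ) → (Vec ℕ m → ℕ) → Set
Computable m f = Σ (PR m) λ c → ∀ xs → Eval c xs (f xs)

RecPred : (m : ℕ) → (Vec ℕ m → Set) → Set
RecPred m P = Σ (PR m) λ c →
  (∀ xs → Σ ℕ λ b → Eval c xs b) × (∀ xs → P xs ⇔ Eval c xs 0)

mutual
  SigmaP : ℕ → (m : ℕ) → (Vec ℕ m → Set) → Set₁
  SigmaP zero    m P = Lift _ (RecPred m P)
  SigmaP (suc p) m P = Σ (Vec ℕ (suc m) → Set) λ Q →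
    PiP p (suc m) Q × (∀ xs → P xs ⇔ Σ ℕ λ z → Q (z ∷ xs))

  PiP : ℕ → (m : ℕ) → (Vec ℕ m → Set) → Set₁
  PiP zero    m P = Lift _ (RecPred m P)
  PiP (suc p) m P = Σ (Vec ℕ (suc m) → Set) λ Q →
    SigmaP p (suc m) Q × (∀ xs → P xs ⇔ (∀ z → Q (z ∷ xs)))

SigmaRel : ℕ → (ℕ → ℕ → Set) → Set₁
SigmaRel p R = SigmaP p 2 (λ v → R (head v) (head (tail v)))

-- Coding of finite sequences (bijective): ⟨a,b⟩ = 2^a(2b+1) - 1

pair : ℕ → ℕ → ℕ
pair a b = 2 ^ a * (2 * b + 1) ∸ 1

vcode : ∀ {n} → Vec ℕ n → ℕ
vcode []       = 0
vcode (x ∷ xs) = suc (pair x (vcode xs))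

_≤c_ : (F E : ℕ → ℕ → Set) → Set
F ≤c E = Σ (ℕ → ℕ) λ g → Computable 1 (λ v → g (head v)) ×
  (∀ x y → F x y ⇔ E (g x) (g y))

IsNaryReduction : (F E : ℕ → ℕ → Set) (n : ℕ) → (ℕ → Vec ℕ n → ℕ) → Set
IsNaryReduction F E n f = ∀ (xs : Vec ℕ n) (i j : Fin n) → i Fin.< j →
  F (lookup xs i) (lookup xs j) ⇔ E (f (toℕ i) xs) (f (toℕ j) xs)

_≤fin_ : (F E : ℕ → ℕ → Set) → Set
F ≤fin E = Σ ((n : ℕ) → ℕ → Vec ℕ n → ℕ) λ f →
  (Σ (PR 3) λ c → ∀ n i (xs : Vec ℕ n) →
      Eval c (n ∷ i ∷ vcode xs ∷ []) (f n i xs)) ×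
  (∀ n → IsNaryReduction F E n (f n))

-- E consists of finite copies: for every index e of a Σₚ relation and every
-- tuple xs, a copy on the entries of xs of an equivalence relation obtained
-- from that relation.  Sending xs to its own copy is a finitary reduction.  Since
-- the copies are uniformly computable and each has finitely many E-classes,
-- the equivalence relation collapsing a suitable noncomputable c.e. set K to
-- a point does not reduce to E: K would be mapped into one copy, hence be
-- contained in a computable set meeting only finitely many points outside K.
-- The universal Σₚ predicate comes from an abstract machine acting on coded
-- programs; it is deterministic, so simulating Eval in one direction is enough.
module Submission where

open import Defs
open import Level using (lift)
open import Data.Fin as Fin using (Fin; zero; suc; toℕ; fromℕ<)
open import Data.Fin.Properties as Fin using (pigeonhole; fromℕ<-injective; toℕ-injective)
open import Data.Nat using (ℕ; zero; suc; pred; _+_; _*_; _∸_; _^_; _≤_; _<_; z≤n; s≤s; s≤s⁻¹; NonZero)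
open import Data.Nat.Properties
open import Data.Product using (Σ; ∃; _×_; _,_; proj₁; proj₂)
open import Data.Sum using (_⊎_; inj₁; inj₂; map)
open import Data.Vec using (Vec; []; _∷_; lookup; head; tail; tabulate)
open import Data.Vec.Properties using (tabulate∘lookup)
open import Function.Base using (_∘_; id)
open import Function.Bundles using (_⇔_; mk⇔; Equivalence)
open import Function.Construct.Composition using () renaming (equivalence to ⇔-trans)
open import Function.Construct.Symmetry using (⇔-sym)
open import Relation.Binary.Construct.Closure.ReflexiveTransitive using (Star; ε; _◅_; _◅◅_; reverse)
open import Relation.Binary.PropositionalEquality
open import Relation.Binary.Structures using (IsEquivalence)
open import Relation.Nullary using (¬_)
open Equivalence using (to; from)

private
  pattern #0 = zero
  pattern #1 = suc zero
  pattern #2 = suc (suc zero)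
  pattern #3 = suc (suc (suc zero))

-- Arithmetic of the pairing function

half : ℕ → ℕ
half zero    = 0
half (suc n) = n ∸ half n

parity : ℕ → ℕ
parity zero    = 0
parity (suc n) = 1 ∸ parity n

half^ : ℕ → ℕ → ℕ
half^ zero    z = z
half^ (suc k) z = half (half^ k z)

-- The exponent of 2 in suc z is the number of trailing ones of z; the
-- count stops growing at the first even iterated half.
trailingOnes : ℕ → ℕ → ℕ
trailingOnes zero    z = 0
trailingOnes (suc k) z = trailingOnes k z + parity (half^ (trailingOnes k z) z)

half-double : ∀ n → half (n + n) ≡ n
half-suc-double : ∀ n → half (suc (n + n)) ≡ n

half-double zero = refl
half-double (suc n) = begin
  (n + suc n) ∸ half (n + suc n)     ≡⟨ cong (λ m → m ∸ half m) (+-suc n n) ⟩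
  suc (n + n) ∸ half (suc (n + n))   ≡⟨ cong (suc (n + n) ∸_) (half-suc-double n) ⟩
  suc (n + n) ∸ n                    ≡⟨ m+n∸n≡m (suc n) n ⟩
  suc n                              ∎
  where open ≡-Reasoning
half-suc-double n = trans (cong (n + n ∸_) (half-double n)) (m+n∸n≡m n n)

parity-double : ∀ n → parity (n + n) ≡ 0
parity-double zero = refl
parity-double (suc n) rewrite +-suc n n | parity-double n = refl

half≤ : ∀ n → half n ≤ n
half≤ zero    = z≤n
half≤ (suc n) = m≤n⇒m≤1+n (m∸n≤m n (half n))

half^≤ : ∀ k n → half^ k n ≤ n
half^≤ zero    n = ≤-refl
half^≤ (suc k) n = ≤-trans (half≤ (half^ k n)) (half^≤ k n)

parity≤1 : ∀ n → parity n ≤ 1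
parity≤1 zero    = z≤n
parity≤1 (suc n) = m∸n≤m 1 (parity n)

trailingOnes≤ : ∀ k n → trailingOnes k n ≤ k
trailingOnes≤ zero    n = z≤n
trailingOnes≤ (suc k) n = ≤-trans
  (+-mono-≤ (trailingOnes≤ k n) (parity≤1 (half^ (trailingOnes k n) n)))
  (≤-reflexive (+-comm k 1))

half^-suc : ∀ k n → half^ (suc k) n ≡ half^ k (half n)
half^-suc zero    n = refl
half^-suc (suc k) n = cong half (half^-suc k n)

-- Both factors are nonzero, so the truncated subtraction in `pair` loses nothing.
suc-pair : ∀ a b → suc (pair a b) ≡ 2 ^ a * (2 * b + 1)
suc-pair a b = suc-pred (2 ^ a * (2 * b + 1)) {{m*n≢0 (2 ^ a) (2 * b + 1) {{m^n≢0 2 a}} {{n≢0}}}}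
  where
  n≢0 : NonZero (2 * b + 1)
  n≢0 = subst NonZero (+-comm 1 (2 * b)) _

double : ∀ n → 2 * n ≡ n + n
double n = cong (n +_) (+-identityʳ n)

pair-zero : ∀ b → pair 0 b ≡ b + b
pair-zero b = suc-injective (begin
  suc (pair 0 b)      ≡⟨ suc-pair 0 b ⟩
  1 * (2 * b + 1)     ≡⟨ *-identityˡ (2 * b + 1) ⟩
  2 * b + 1           ≡⟨ +-comm (2 * b) 1 ⟩
  suc (2 * b)         ≡⟨ cong suc (double b) ⟩
  suc (b + b)         ∎)
  where open ≡-Reasoning

pair-suc : ∀ a b → pair (suc a) b ≡ suc (pair a b + pair a b)
pair-suc a b = suc-injective (begin
  suc (pair (suc a) b)             ≡⟨ suc-pair (suc a) b ⟩
  2 * 2 ^ a * (2 * b + 1)          ≡⟨ *-assoc 2 (2 ^ a) (2 * b + 1) ⟩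
  2 * (2 ^ a * (2 * b + 1))        ≡⟨ cong (2 *_) (suc-pair a b) ⟨
  2 * suc (pair a b)               ≡⟨ double (suc (pair a b)) ⟩
  suc (pair a b + suc (pair a b))  ≡⟨ cong suc (+-suc (pair a b) (pair a b)) ⟩
  suc (suc (pair a b + pair a b))  ∎)
  where open ≡-Reasoning

-- Opaque so that literal tags in the first component are never unfolded
-- into powers of two.
opaque
  ⟨_,_⟩ : ℕ → ℕ → ℕ
  ⟨ a , b ⟩ = pair a b

  ⟨⟩≡pair : ∀ a b → ⟨ a , b ⟩ ≡ pair a b
  ⟨⟩≡pair a b = refl

  ⟨0,⟩ : ∀ b → ⟨ 0 , b ⟩ ≡ b + b
  ⟨0,⟩ = pair-zero

  ⟨suc,⟩ : ∀ a b → ⟨ suc a , b ⟩ ≡ suc (⟨ a , b ⟩ + ⟨ a , b ⟩)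
  ⟨suc,⟩ = pair-suc

half^-⟨⟩ : ∀ k a b → half^ k ⟨ k + a , b ⟩ ≡ ⟨ a , b ⟩
half^-⟨⟩ zero    a b = refl
half^-⟨⟩ (suc k) a b = begin
  half^ (suc k) ⟨ suc k + a , b ⟩                      ≡⟨ half^-suc k _ ⟩
  half^ k (half ⟨ suc k + a , b ⟩)                     ≡⟨ cong (half^ k ∘ half) (⟨suc,⟩ (k + a) b) ⟩
  half^ k (half (suc (⟨ k + a , b ⟩ + ⟨ k + a , b ⟩))) ≡⟨ cong (half^ k) (half-suc-double ⟨ k + a , b ⟩) ⟩
  half^ k ⟨ k + a , b ⟩                                ≡⟨ half^-⟨⟩ k a b ⟩
  ⟨ a , b ⟩                                            ∎
  where open ≡-Reasoning

half^-⟨⟩′ : ∀ a b → half^ a ⟨ a , b ⟩ ≡ b + b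
half^-⟨⟩′ a b = trans (cong (λ c → half^ a ⟨ c , b ⟩) (sym (+-identityʳ a)))
                        (trans (half^-⟨⟩ a 0 b) (⟨0,⟩ b))

-- While the count is below the exponent, the iterated half is a pair with positive first component,
-- hence odd, so every round adds one.
trailingOnes-≤ : ∀ k a b → trailingOnes k ⟨ k + a , b ⟩ ≡ k
trailingOnes-≤ zero    a b = refl
trailingOnes-≤ (suc k) a b rewrite sym (+-suc k a) | trailingOnes-≤ k (suc a) b
  | half^-⟨⟩ k (suc a) b | ⟨suc,⟩ a b | parity-double ⟨ a , b ⟩ = +-comm k 1

-- Once the count is `a`, the iterated half is the even number `b + b`.
trailingOnes-≥ : ∀ k a b → trailingOnes (k + a) ⟨ a , b ⟩ ≡ a
trailingOnes-≥ zero a b = trans (cong (λ c → trailingOnes a ⟨ c , b ⟩) (sym (+-identityʳ a))) (trailingOnes-≤ a 0 b)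
trailingOnes-≥ (suc k) a b rewrite trailingOnes-≥ k a b | half^-⟨⟩′ a b | parity-double b = +-identityʳ a

a≤⟨⟩ : ∀ a b → a ≤ ⟨ a , b ⟩
a≤⟨⟩ zero    b = z≤n
a≤⟨⟩ (suc a) b rewrite ⟨suc,⟩ a b = s≤s (m≤n⇒m≤n+o ⟨ a , b ⟩ (a≤⟨⟩ a b))

opaque
  fst : ℕ → ℕ
  fst z = trailingOnes z z

  -- In binary, `⟨ a , b ⟩` is `b` followed by a zero and `a` ones; the extra halving removes the
  -- zero.
  snd : ℕ → ℕ
  snd z = half^ (suc (fst z)) z

  fst-⟨⟩ : ∀ a b → fst ⟨ a , b ⟩ ≡ a
  fst-⟨⟩ a b = trans (cong (λ k → trailingOnes k ⟨ a , b ⟩) (sym (m∸n+n≡m (a≤⟨⟩ a b))))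
                     (trailingOnes-≥ (⟨ a , b ⟩ ∸ a) a b)

  snd-⟨⟩ : ∀ a b → snd ⟨ a , b ⟩ ≡ b
  snd-⟨⟩ a b rewrite fst-⟨⟩ a b | half^-⟨⟩′ a b = half-double b

  fst-0 : fst 0 ≡ 0
  fst-0 = refl

  snd-0 : snd 0 ≡ 0
  snd-0 = refl

  fst≤ : ∀ z → fst z ≤ z
  fst≤ z = trailingOnes≤ z z

  snd≤ : ∀ z → snd z ≤ z
  snd≤ z = half^≤ (suc (fst z)) z

-- Coded finite sequences

cons : ℕ → ℕ → ℕ
cons x s = suc ⟨ x , s ⟩

hd tl : ℕ → ℕ
hd s = fst (pred s)
tl s = snd (pred s)

drop : ℕ → ℕ → ℕ
drop zero    s = s
drop (suc i) s = tl (drop i s)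

nth : ℕ → ℕ → ℕ
nth i s = hd (drop i s)

drop-suc : ∀ i s → drop (suc i) s ≡ drop i (tl s)
drop-suc zero    s = refl
drop-suc (suc i) s = cong tl (drop-suc i s)

nth-suc : ∀ i s → nth (suc i) s ≡ nth i (tl s)
nth-suc i s = cong hd (drop-suc i s)

hd-cons : ∀ x s → hd (cons x s) ≡ x
hd-cons = fst-⟨⟩

tl-cons : ∀ x s → tl (cons x s) ≡ s
tl-cons = snd-⟨⟩

nth-suc-cons : ∀ i x s → nth (suc i) (cons x s) ≡ nth i s
nth-suc-cons i x s = trans (nth-suc i (cons x s)) (cong (nth i) (tl-cons x s))

drop≤ : ∀ i s → drop i s ≤ s
drop≤ zero    s = ≤-refl
drop≤ (suc i) s = ≤-trans (snd≤ _) (≤-trans pred[n]≤n (drop≤ i s))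

-- The bound is uniform in `i`, positions past the end included; it will bound the number of classes
-- in a copy.
nth≤ : ∀ i s → nth i s ≤ s
nth≤ i s = ≤-trans (fst≤ _) (≤-trans pred[n]≤n (drop≤ i s))

code : ∀ {n} → Vec ℕ n → ℕ
code []       = 0
code (x ∷ xs) = cons x (code xs)

code≡vcode : ∀ {n} (xs : Vec ℕ n) → code xs ≡ vcode xs
code≡vcode []       = refl
code≡vcode (x ∷ xs) = cong suc (trans (⟨⟩≡pair x (code xs)) (cong (pair x) (code≡vcode xs)))

nth-code : ∀ {n} (xs : Vec ℕ n) (i : Fin n) → nth (toℕ i) (code xs) ≡ lookup xs i
nth-code (x ∷ xs) zero    = hd-cons x (code xs)
nth-code (x ∷ xs) (suc i) = trans (nth-suc-cons (toℕ i) x (code xs)) (nth-code xs i)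

-- Packs finitely many witnesses into one number, as needed to move a bounded quantifier past an
-- existential one.
finite-choice : ∀ k (f : ∀ i → i < k → ℕ) → Σ ℕ λ s → ∀ i (i<k : i < k) → nth i s ≡ f i i<k
finite-choice zero    f = 0 , λ _ ()
finite-choice (suc k) f with finite-choice k (λ i i<k → f (suc i) (s≤s i<k))
... | s , eq = cons (f 0 (s≤s z≤n)) s , λ where
  zero    (s≤s z≤n) → hd-cons _ _
  (suc i) (s≤s i<k) → trans (nth-suc-cons i _ s) (eq i i<k)

-- Computable functions

ComputableMap : (n m : ℕ) → (Vec ℕ n → Vec ℕ m) → Set
ComputableMap n m G = Σ (Vec (PR n) m) λ gs → ∀ xs → Evals gs xs (G xs)

module _ {n : ℕ} where

  ext : ∀ {f g} → Computable n f → (∀ xs → f xs ≡ g xs) → Computable n g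
  ext (c , ev) eq = c , λ xs → subst (Eval c xs) (eq xs) (ev xs)

  []ᶜ : ComputableMap n 0 (λ _ → [])
  []ᶜ = [] , λ _ → es-[]

  infixr 5 _∷ᶜ_
  _∷ᶜ_ : ∀ {m f G} → Computable n f → ComputableMap n m G → ComputableMap n (suc m) (λ xs → f xs ∷ G xs)
  (c , ev) ∷ᶜ (cs , evs) = c ∷ cs , λ xs → es-∷ (ev xs) (evs xs)

  var : (i : Fin n) → Computable n (λ xs → lookup xs i)
  var i = proj i , λ _ → e-proj

  compose : ∀ {m f G} → Computable m f → ComputableMap n m G → Computable n (λ xs → f (G xs))
  compose (c , ev) (cs , evs) = comp c cs , λ xs → e-comp (evs xs) (ev _)

  lift₁ : ∀ (f : ℕ → ℕ) {g} → Computable 1 (f ∘ head) → Computable n g → Computable n (λ xs → f (g xs))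
  lift₁ f c d = compose c (d ∷ᶜ []ᶜ)

  lift₂ : ∀ (f : ℕ → ℕ → ℕ) {g h} → Computable 2 (λ v → f (head v) (head (tail v))) →
          Computable n g → Computable n h → Computable n (λ xs → f (g xs) (h xs))
  lift₂ f c d e = compose c (d ∷ᶜ e ∷ᶜ []ᶜ)

  sucᶜ : ∀ {f} → Computable n f → Computable n (λ xs → suc (f xs))
  sucᶜ (c , ev) = comp succ (c ∷ []) , λ xs → e-comp (es-∷ (ev xs) es-[]) e-succ

  const : (k : ℕ) → Computable n (λ _ → k)
  const zero    = zer , λ _ → e-zer
  const (suc k) = sucᶜ (const k)

  -- Any `f` satisfying the recursion equations qualifies. In `h`, variable 0 is the counter,
  -- variable 1 the previous value, and the parameters follow.
  primRec : ∀ {g h} (f : ℕ → Vec ℕ n → ℕ) → Computable n g → Computable (2 + n) h →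
            (∀ xs → g xs ≡ f 0 xs) → (∀ k xs → h (k ∷ f k xs ∷ xs) ≡ f (suc k) xs) →
            Computable (suc n) (λ v → f (head v) (tail v))
  primRec f (c , evc) (d , evd) base step = prec c d , λ { (k ∷ xs) → go k xs }
    where
    go : ∀ k xs → Eval (prec c d) (k ∷ xs) (f k xs)
    go zero    xs = e-prec0 (subst (Eval c xs) (base xs) (evc xs))
    go (suc k) xs = e-precS (go k xs) (subst (Eval d _) (step k xs) (evd _))

  projections : ∀ {m} (s : Fin m → Fin n) → ComputableMap n m (λ xs → tabulate (lookup xs ∘ s))
  projections {zero}  s = []ᶜ
  projections {suc m} s = var (s zero) ∷ᶜ projections (s ∘ suc)

mapExt : ∀ {n m G H} → ComputableMap n m G → (∀ xs → G xs ≡ H xs) → ComputableMap n m H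
mapExt (cs , evs) eq = cs , λ xs → subst (Evals cs xs) (eq xs) (evs xs)

composeMap : ∀ {n m l G H} → ComputableMap m l G → ComputableMap n m H → ComputableMap n l (λ xs → G (H xs))
composeMap {n} {m} ([] , evs) _ = [] , λ xs → go (evs _)
  where
  go : ∀ {xs : Vec ℕ m} {zs : Vec ℕ n} {ys : Vec ℕ 0} → Evals [] xs ys → Evals [] zs ys
  go es-[] = es-[]
composeMap {G = G} {H} (c ∷ cs , evs) D@(ds , evd) =
  comp c ds ∷ proj₁ rest , λ xs → go (evs (H xs)) (evd xs) (proj₂ rest xs)
  where
  tl-evs : ∀ {xs ys} → Evals (c ∷ cs) xs ys → Evals cs xs (tail ys)
  tl-evs (es-∷ _ es) = es
  rest = composeMap {G = tail ∘ G} {H} (cs , tl-evs ∘ evs) D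
  go : ∀ {xs zs ys} → Evals (c ∷ cs) zs ys → Evals ds xs zs → Evals (proj₁ rest) xs (tail ys) →
       Evals (comp c ds ∷ proj₁ rest) xs ys
  go (es-∷ e _) es rs = es-∷ (e-comp es e) rs

tailᶜ : ∀ {n} → ComputableMap (suc n) n tail
tailᶜ = mapExt (projections suc) λ { (x ∷ xs) → tabulate∘lookup xs }

headᶜ : ∀ {n} → Computable (suc n) head
headᶜ = ext (var zero) λ { (x ∷ xs) → refl }

-- Computability of arithmetic and sequence operations

private variable
  n     : ℕ
  f g h : Vec ℕ n → ℕ

predᶜ : Computable n f → Computable n (λ v → pred (f v))
predᶜ = lift₁ pred (primRec (λ k _ → pred k) (const 0) (var #0) (λ _ → refl) (λ _ _ → refl))

infixl 7 _*ᶜ_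
infixl 6 _+ᶜ_ _∸ᶜ_

_+ᶜ_ : Computable n f → Computable n g → Computable n (λ v → f v + g v)
_+ᶜ_ = lift₂ _+_ (primRec (λ k xs → k + head xs) headᶜ (sucᶜ (var #1)) (λ _ → refl) (λ _ _ → refl))

_*ᶜ_ : Computable n f → Computable n g → Computable n (λ v → f v * g v)
_*ᶜ_ = lift₂ _*_ (primRec (λ k xs → k * head xs) (const 0) (var #2 +ᶜ var #1)
                    (λ _ → refl) (λ { _ (_ ∷ _) → refl }))

_∸ᶜ_ : Computable n f → Computable n g → Computable n (λ v → f v ∸ g v)
-- The recursion runs on the subtrahend, so the arguments are swapped.
_∸ᶜ_ c d = lift₂ (λ y x → x ∸ y)
             (primRec (λ k xs → head xs ∸ k) headᶜ (predᶜ (var #1)) (λ _ → refl)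
                (λ k xs → pred[m∸n]≡m∸[1+n] (head xs) k))
             d c

ifz : ℕ → ℕ → ℕ → ℕ
ifz zero    a b = a
ifz (suc _) a b = b

ifzᶜ : Computable n f → Computable n g → Computable n h →
       Computable n (λ v → ifz (f v) (g v) (h v))
ifzᶜ c d e = compose (primRec (λ k xs → ifz k (head xs) (head (tail xs))) headᶜ (var #3)
                        (λ { _ → refl }) (λ { _ (_ ∷ _ ∷ _) → refl }))
                     (c ∷ᶜ d ∷ᶜ e ∷ᶜ []ᶜ)

halfᶜ : Computable n f → Computable n (λ v → half (f v))
halfᶜ = lift₁ half (primRec (λ k _ → half k) (const 0) (var #0 ∸ᶜ var #1) (λ _ → refl) (λ _ _ → refl))

parityᶜ : Computable n f → Computable n (λ v → parity (f v))
parityᶜ = lift₁ parity (primRec (λ k _ → parity k) (const 0) (const 1 ∸ᶜ var #1) (λ _ → refl) (λ _ _ → refl))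

half^ᶜ : Computable n f → Computable n g → Computable n (λ v → half^ (f v) (g v))
half^ᶜ = lift₂ half^ (primRec (λ k xs → half^ k (head xs)) headᶜ (halfᶜ (var #1)) (λ _ → refl) (λ _ _ → refl))

trailingOnesᶜ : Computable n f → Computable n g → Computable n (λ v → trailingOnes (f v) (g v))
trailingOnesᶜ = lift₂ trailingOnes
  (primRec (λ k xs → trailingOnes k (head xs)) (const 0)
     (var #1 +ᶜ parityᶜ (half^ᶜ (var #1) (var #2))) (λ _ → refl) (λ { _ (_ ∷ _) → refl }))

⟨⟩ᶜ : Computable n f → Computable n g → Computable n (λ v → ⟨ f v , g v ⟩)
⟨⟩ᶜ = lift₂ ⟨_,_⟩
  (primRec (λ k xs → ⟨ k , head xs ⟩) (headᶜ +ᶜ headᶜ) (sucᶜ (var #1 +ᶜ var #1))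
     (λ xs → sym (⟨0,⟩ (head xs))) (λ k xs → sym (⟨suc,⟩ k (head xs))))

opaque
  unfolding fst

  fstᶜ : Computable n f → Computable n (λ v → fst (f v))
  fstᶜ c = trailingOnesᶜ c c

  sndᶜ : Computable n f → Computable n (λ v → snd (f v))
  sndᶜ c = half^ᶜ (sucᶜ (fstᶜ c)) c

consᶜ : Computable n f → Computable n g → Computable n (λ v → cons (f v) (g v))
consᶜ c d = sucᶜ (⟨⟩ᶜ c d)

hdᶜ : Computable n f → Computable n (λ v → hd (f v))
hdᶜ c = fstᶜ (predᶜ c)

tlᶜ : Computable n f → Computable n (λ v → tl (f v))
tlᶜ c = sndᶜ (predᶜ c)

nthᶜ : Computable n f → Computable n g → Computable n (λ v → nth (f v) (g v))
nthᶜ c d = hdᶜ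
  (lift₂ drop (primRec (λ k xs → drop k (head xs)) headᶜ (tlᶜ (var #1)) (λ _ → refl) (λ _ _ → refl)) c d)

switch : ∀ {n} → ℕ → Vec ℕ n → ℕ
switch t []       = 0
switch t (x ∷ xs) = ifz t x (switch (pred t) xs)

switchᶜ : ∀ {m G} → Computable n f → ComputableMap n m G → Computable n (λ v → switch (f v) (G v))
switchᶜ c D = compose (go _) (c ∷ᶜ D)
  where
  go : ∀ m → Computable (suc m) (λ v → switch (head v) (tail v))
  go zero    = ext (const 0) λ { (_ ∷ []) → refl }
  go (suc m) = ext
    (ifzᶜ (var #0) (var #1) (compose (go m) (predᶜ (var #0) ∷ᶜ composeMap tailᶜ tailᶜ)))
    λ { (_ ∷ _ ∷ _) → refl }

-- An abstract machine for coded programs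

-- A state ⟨ v , K ⟩ consists of a current value v and a stack K of frames
-- ⟨ t , p ⟩ with tag t and payload p.  Tag 0 halts (the empty stack reads
-- as a frame with tag 0); tags 1-4, 7, 8, 10 are the coded programs and
-- vectors of programs; tags 5, 6, 9, 11 are return frames.
exec : ℕ → ℕ → ℕ → ℕ → ℕ
exec t p v K = switch t
  ( ⟨ v , K ⟩
  ∷ ⟨ 0 , K ⟩
  ∷ ⟨ suc (hd v) , K ⟩
  ∷ ⟨ nth p v , K ⟩
  ∷ ⟨ v , cons (snd p) (cons ⟨ 5 , ⟨ fst p , v ⟩ ⟩ K) ⟩
  ∷ ⟨ snd p , cons (fst p) (cons ⟨ 6 , v ⟩ K) ⟩
  ∷ ⟨ cons v p , K ⟩
  ∷ ⟨ v , cons (snd p) (cons (fst p) K) ⟩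
  ∷ ifz (hd v) ⟨ tl v , cons (fst p) K ⟩
        ⟨ cons (pred (hd v)) (tl v) , cons ⟨ 8 , p ⟩ (cons ⟨ 9 , ⟨ snd p , v ⟩ ⟩ K) ⟩
  ∷ ⟨ cons (pred (hd (snd p))) (cons v (tl (snd p))) , cons (fst p) K ⟩
  ∷ ⟨ cons 0 v , cons p (cons ⟨ 11 , ⟨ p , cons 0 v ⟩ ⟩ K) ⟩
  ∷ ifz v ⟨ hd (snd p) , K ⟩
        ⟨ cons (suc (hd (snd p))) (tl (snd p))
        , cons (fst p) (cons ⟨ 11 , ⟨ fst p , cons (suc (hd (snd p))) (tl (snd p)) ⟩ ⟩ K) ⟩
  ∷ [])

step : ℕ → ℕ
step s = exec (fst (hd (snd s))) (snd (hd (snd s))) (fst s) (tl (snd s))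

run : ℕ → ℕ → ℕ
run zero    s = s
run (suc n) s = step (run n s)

execᶜ : ∀ {t p v K} → Computable n t → Computable n p → Computable n v → Computable n K →
        Computable n (λ xs → exec (t xs) (p xs) (v xs) (K xs))
execᶜ t p v K = switchᶜ t
  (  ⟨⟩ᶜ v K
  ∷ᶜ ⟨⟩ᶜ (const 0) K
  ∷ᶜ ⟨⟩ᶜ (sucᶜ (hdᶜ v)) K
  ∷ᶜ ⟨⟩ᶜ (nthᶜ p v) K
  ∷ᶜ ⟨⟩ᶜ v (consᶜ (sndᶜ p) (consᶜ (⟨⟩ᶜ (const 5) (⟨⟩ᶜ (fstᶜ p) v)) K))
  ∷ᶜ ⟨⟩ᶜ (sndᶜ p) (consᶜ (fstᶜ p) (consᶜ (⟨⟩ᶜ (const 6) v) K))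
  ∷ᶜ ⟨⟩ᶜ (consᶜ v p) K
  ∷ᶜ ⟨⟩ᶜ v (consᶜ (sndᶜ p) (consᶜ (fstᶜ p) K))
  ∷ᶜ ifzᶜ (hdᶜ v) (⟨⟩ᶜ (tlᶜ v) (consᶜ (fstᶜ p) K))
          (⟨⟩ᶜ (consᶜ (predᶜ (hdᶜ v)) (tlᶜ v))
               (consᶜ (⟨⟩ᶜ (const 8) p) (consᶜ (⟨⟩ᶜ (const 9) (⟨⟩ᶜ (sndᶜ p) v)) K)))
  ∷ᶜ ⟨⟩ᶜ (consᶜ (predᶜ (hdᶜ (sndᶜ p))) (consᶜ v (tlᶜ (sndᶜ p)))) (consᶜ (fstᶜ p) K)
  ∷ᶜ ⟨⟩ᶜ (consᶜ (const 0) v) (consᶜ p (consᶜ (⟨⟩ᶜ (const 11) (⟨⟩ᶜ p (consᶜ (const 0) v))) K))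
  ∷ᶜ ifzᶜ v (⟨⟩ᶜ (hdᶜ (sndᶜ p)) K)
          (⟨⟩ᶜ (consᶜ (sucᶜ (hdᶜ (sndᶜ p))) (tlᶜ (sndᶜ p)))
               (consᶜ (fstᶜ p) (consᶜ (⟨⟩ᶜ (const 11)
                  (⟨⟩ᶜ (fstᶜ p) (consᶜ (sucᶜ (hdᶜ (sndᶜ p))) (tlᶜ (sndᶜ p))))) K)))
  ∷ᶜ []ᶜ)

stepᶜ : Computable n f → Computable n (λ v → step (f v))
stepᶜ s = execᶜ (fstᶜ (hdᶜ (sndᶜ s))) (sndᶜ (hdᶜ (sndᶜ s))) (fstᶜ s) (tlᶜ (sndᶜ s))

runᶜ : Computable n f → Computable n g → Computable n (λ v → run (f v) (g v))
runᶜ = lift₂ run (primRec (λ k xs → run k (head xs)) headᶜ (stepᶜ (var #1)) (λ _ → refl) (λ _ _ → refl))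

-- Coding of programs and simulation of evaluation

mutual
  ⌜_⌝ : ∀ {n} → PR n → ℕ
  ⌜ zer ⌝       = ⟨ 1 , 0 ⟩
  ⌜ succ ⌝      = ⟨ 2 , 0 ⟩
  ⌜ proj i ⌝    = ⟨ 3 , toℕ i ⟩
  ⌜ comp f gs ⌝ = ⟨ 7 , ⟨ ⌜ f ⌝ , ⌜ gs ⌝ᵛ ⟩ ⟩
  ⌜ prec g h ⌝  = ⟨ 8 , ⟨ ⌜ g ⌝ , ⌜ h ⌝ ⟩ ⟩
  ⌜ mu f ⌝      = ⟨ 10 , ⌜ f ⌝ ⟩

  -- The empty vector shares the code of `zer`, because its value 0 is the code of the empty
  -- sequence.
  ⌜_⌝ᵛ : ∀ {n m} → Vec (PR n) m → ℕ
  ⌜ [] ⌝ᵛ     = ⟨ 1 , 0 ⟩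
  ⌜ g ∷ gs ⌝ᵛ = ⟨ 4 , ⟨ ⌜ g ⌝ , ⌜ gs ⌝ᵛ ⟩ ⟩

infix  4 _⟶*_
infixr 3 _⨾_

_⟶*_ : ℕ → ℕ → Set
s ⟶* s′ = ∃ λ n → run n s ≡ s′

run-+ : ∀ m n s → run (m + n) s ≡ run m (run n s)
run-+ zero    n s = refl
run-+ (suc m) n s = cong step (run-+ m n s)

_⨾_ : ∀ {s t u} → s ⟶* t → t ⟶* u → s ⟶* u
_⨾_ {s} (m , p) (n , q) = n + m , trans (run-+ n m s) (trans (cong (run n) p) q)

frame : ∀ {t p v K s} → exec t p v K ≡ s → ⟨ v , cons ⟨ t , p ⟩ K ⟩ ⟶* s
frame {t} {p} {v} {K} eq = 1 , trans step≡ eq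
  where
  step≡ : step ⟨ v , cons ⟨ t , p ⟩ K ⟩ ≡ exec t p v K
  step≡ rewrite snd-⟨⟩ v (cons ⟨ t , p ⟩ K) | fst-⟨⟩ v (cons ⟨ t , p ⟩ K)
              | fst-⟨⟩ ⟨ t , p ⟩ K | snd-⟨⟩ ⟨ t , p ⟩ K | fst-⟨⟩ t p | snd-⟨⟩ t p = refl

-- Vectors are evaluated from the back: frame 5 keeps the head program and the arguments while the
-- tail runs.
exec-cons : ∀ g gs v K → exec 4 ⟨ g , gs ⟩ v K ≡ ⟨ v , cons gs (cons ⟨ 5 , ⟨ g , v ⟩ ⟩ K) ⟩
exec-cons g gs v K rewrite fst-⟨⟩ g gs | snd-⟨⟩ g gs = refl

exec-head : ∀ g v ys K → exec 5 ⟨ g , v ⟩ ys K ≡ ⟨ v , cons g (cons ⟨ 6 , ys ⟩ K) ⟩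
exec-head g v ys K rewrite fst-⟨⟩ g v | snd-⟨⟩ g v = refl

exec-comp : ∀ f gs v K → exec 7 ⟨ f , gs ⟩ v K ≡ ⟨ v , cons gs (cons f K) ⟩
exec-comp f gs v K rewrite fst-⟨⟩ f gs | snd-⟨⟩ f gs = refl

exec-prec-zero : ∀ g h v K → exec 8 ⟨ g , h ⟩ (cons 0 v) K ≡ ⟨ v , cons g K ⟩
exec-prec-zero g h v K rewrite hd-cons 0 v | tl-cons 0 v | fst-⟨⟩ g h = refl

exec-prec-suc : ∀ g h k v K → exec 8 ⟨ g , h ⟩ (cons (suc k) v) K ≡
                ⟨ cons k v , cons ⟨ 8 , ⟨ g , h ⟩ ⟩ (cons ⟨ 9 , ⟨ h , cons (suc k) v ⟩ ⟩ K) ⟩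
exec-prec-suc g h k v K rewrite hd-cons (suc k) v | tl-cons (suc k) v | snd-⟨⟩ g h = refl

exec-prec-return : ∀ h k v z K → exec 9 ⟨ h , cons (suc k) v ⟩ z K ≡ ⟨ cons k (cons z v) , cons h K ⟩
exec-prec-return h k v z K rewrite fst-⟨⟩ h (cons (suc k) v) | snd-⟨⟩ h (cons (suc k) v)
  | hd-cons (suc k) v | tl-cons (suc k) v = refl

exec-mu-found : ∀ f z v K → exec 11 ⟨ f , cons z v ⟩ 0 K ≡ ⟨ z , K ⟩
exec-mu-found f z v K rewrite snd-⟨⟩ f (cons z v) | hd-cons z v = refl

exec-mu-next : ∀ f z v k K → exec 11 ⟨ f , cons z v ⟩ (suc k) K ≡
               ⟨ cons (suc z) v , cons f (cons ⟨ 11 , ⟨ f , cons (suc z) v ⟩ ⟩ K) ⟩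
exec-mu-next f z v k K rewrite fst-⟨⟩ f (cons z v) | snd-⟨⟩ f (cons z v) | hd-cons z v | tl-cons z v = refl

-- Each trial below `y` returns a positive value, upon which frame 11 moves to the next candidate.
-- Trials are assumed to work over any stack, since they run on top of frame 11.
mu-search : ∀ f v y K →
            (∀ z → z < y → ∃ λ k → ∀ K → ⟨ cons z v , cons f K ⟩ ⟶* ⟨ suc k , K ⟩) →
            ∀ z → z ≤ y → ⟨ cons 0 v , cons f (cons ⟨ 11 , ⟨ f , cons 0 v ⟩ ⟩ K) ⟩ ⟶*
                          ⟨ cons z v , cons f (cons ⟨ 11 , ⟨ f , cons z v ⟩ ⟩ K) ⟩
mu-search f v y K below zero    _   = 0 , refl
mu-search f v y K below (suc z) z<y with below z z<y
... | k , sim = mu-search f v y K below z (<⇒≤ z<y) ⨾ sim _ ⨾ frame (exec-mu-next f z v k K)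

mutual
  -- The stack is arbitrary so that subcomputations can run on top of return frames.
  simulate : ∀ {n} {c : PR n} {xs y} → Eval c xs y → ∀ K → ⟨ code xs , cons ⌜ c ⌝ K ⟩ ⟶* ⟨ y , K ⟩
  simulate e-zer K = frame refl
  simulate (e-succ {x}) K = frame (cong (λ z → ⟨ suc z , K ⟩) (hd-cons x 0))
  simulate (e-proj {i = i} {xs}) K = frame (cong ⟨_, K ⟩ (nth-code xs i))
  simulate (e-comp es e) K = frame (exec-comp _ _ _ K) ⨾ simulateᵛ es _ ⨾ simulate e K
  simulate (e-prec0 e) K = frame (exec-prec-zero _ _ _ K) ⨾ simulate e K
  simulate (e-precS e e′) K =
    frame (exec-prec-suc _ _ _ _ K) ⨾ simulate e _ ⨾ frame (exec-prec-return _ _ _ _ K) ⨾ simulate e′ K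
  simulate (e-mu {f = f} {xs} {y} e below) K =
    frame refl
    ⨾ mu-search ⌜ f ⌝ (code xs) y K
        (λ z z<y → proj₁ (below z z<y) , λ K′ → simulate (proj₂ (below z z<y)) K′) y ≤-refl
    ⨾ simulate e _
    ⨾ frame (exec-mu-found ⌜ f ⌝ y (code xs) K)

  simulateᵛ : ∀ {n m} {cs : Vec (PR n) m} {xs ys} → Evals cs xs ys →
              ∀ K → ⟨ code xs , cons ⌜ cs ⌝ᵛ K ⟩ ⟶* ⟨ code ys , K ⟩
  simulateᵛ es-[] K = frame refl
  simulateᵛ (es-∷ e es) K =
    frame (exec-cons _ _ _ K) ⨾ simulateᵛ es _ ⨾ frame (exec-head _ _ _ K) ⨾ simulate e _ ⨾ frame refl

-- Halting and uniqueness of values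

result : ℕ → ℕ
result s = ifz (snd s) (suc (fst s)) 0

-- 0 while the machine is running, and suc y once it has halted with value y.
output : ℕ → ℕ → ℕ → ℕ
output e v n = result (run n ⟨ v , cons e 0 ⟩)

outputᶜ : Computable n f → Computable n g → Computable n h → Computable n (λ v → output (f v) (g v) (h v))
outputᶜ e v k = ifzᶜ (sndᶜ state) (sucᶜ (fstᶜ state)) (const 0)
  where state = runᶜ k (⟨⟩ᶜ v (consᶜ e (const 0)))

Halted : ℕ → ℕ → Set
Halted y s = fst s ≡ y × snd s ≡ 0

-- The empty stack reads as a frame with tag 0 over an empty stack, and tag 0 preserves value and
-- stack.
halted-step : ∀ {y s} → Halted y s → Halted y (step s)
halted-step {y} {s} (refl , q) rewrite q | fst-0 | fst-0 | snd-0 = fst-⟨⟩ (fst s) 0 , snd-⟨⟩ (fst s) 0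

halted-run : ∀ {y s} k → Halted y s → Halted y (run k s)
halted-run zero    h = h
halted-run (suc k) h = halted-step (halted-run k h)

output⇒halted : ∀ e v n {y} → output e v n ≡ suc y → Halted y (run n ⟨ v , cons e 0 ⟩)
output⇒halted e v n eq with snd (run n ⟨ v , cons e 0 ⟩) | eq
... | zero | refl = refl , refl

output-unique-≤ : ∀ e v {m n x y} → m ≤ n → output e v m ≡ suc x → output e v n ≡ suc y → x ≡ y
output-unique-≤ e v {m} {n} m≤n p q =
  trans (sym (proj₁ (subst (Halted _) run≡ (halted-run (n ∸ m) (output⇒halted e v m p)))))
        (proj₁ (output⇒halted e v n q))
  where
  run≡ : run (n ∸ m) (run m ⟨ v , cons e 0 ⟩) ≡ run n ⟨ v , cons e 0 ⟩
  run≡ = trans (sym (run-+ (n ∸ m) m _)) (cong (λ k → run k _) (m∸n+n≡m m≤n))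

output-unique : ∀ e v m n {x y} → output e v m ≡ suc x → output e v n ≡ suc y → x ≡ y
output-unique e v m n p q with ≤-total m n
... | inj₁ m≤n = output-unique-≤ e v m≤n p q
... | inj₂ n≤m = sym (output-unique-≤ e v n≤m q p)

eval⇒output : ∀ {c : PR n} {xs y} → Eval c xs y → ∃ λ k → output ⌜ c ⌝ (code xs) k ≡ suc y
eval⇒output {y = y} ev with simulate ev 0
... | k , eq = k , trans (cong result eq) result-⟨⟩
  where
  result-⟨⟩ : result ⟨ y , 0 ⟩ ≡ suc y
  result-⟨⟩ rewrite snd-⟨⟩ y 0 | fst-⟨⟩ y 0 = refl

-- Both derivations simulate the same machine run, which keeps its value after halting.
eval-deterministic : ∀ {c : PR n} {xs x y} → Eval c xs x → Eval c xs y → x ≡ y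
eval-deterministic {c = c} {xs} d e with eval⇒output d | eval⇒output e
... | m , p | k , q = output-unique ⌜ c ⌝ (code xs) m k p q

-- Closure properties of the arithmetical hierarchy

private variable
  m p : ℕ
  P Q : Vec ℕ n → Set
  G   : Vec ℕ n → Vec ℕ m

recPred : Computable m f → (∀ xs → P xs ⇔ f xs ≡ 0) → RecPred m P
recPred {f = f} (c , ev) iff = c , (λ xs → f xs , ev xs) , λ xs → mk⇔
  (λ Pxs → subst (Eval c xs) (to (iff xs) Pxs) (ev xs))
  (λ e → from (iff xs) (eval-deterministic (ev xs) e))

recPred⁻¹ : RecPred m P → ∃ λ f → Computable m f × (∀ xs → P xs ⇔ f xs ≡ 0)
recPred⁻¹ {P = P} (c , total , iff) = (λ xs → proj₁ (total xs)) , (c , λ xs → proj₂ (total xs)) , λ xs → mk⇔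
  (λ Pxs → eval-deterministic (proj₂ (total xs)) (to (iff xs) Pxs))
  (λ eq → from (iff xs) (subst (Eval c xs) eq (proj₂ (total xs))))

rec-resp : RecPred m P → (∀ xs → P xs ⇔ Q xs) → RecPred m Q
rec-resp (c , total , iff) P⇔Q = c , total , λ xs → ⇔-trans (⇔-sym (P⇔Q xs)) (iff xs)

rec-∘ : RecPred m P → ComputableMap n m G → RecPred n (P ∘ G)
rec-∘ {G = G} R D with recPred⁻¹ R
... | f , F , iff = recPred (compose F D) (iff ∘ G)

rec-× : RecPred m P → RecPred m Q → RecPred m (λ xs → P xs × Q xs)
rec-× R S with recPred⁻¹ R | recPred⁻¹ S
... | f , F , i | g , G , j = recPred (F +ᶜ G) λ xs → mk⇔
  (λ (Pxs , Qxs) → cong₂ _+_ (to (i xs) Pxs) (to (j xs) Qxs))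
  (λ eq → from (i xs) (m+n≡0⇒m≡0 (f xs) eq) , from (j xs) (m+n≡0⇒n≡0 (f xs) eq))

rec-⊎ : RecPred m P → RecPred m Q → RecPred m (λ xs → P xs ⊎ Q xs)
rec-⊎ R S with recPred⁻¹ R | recPred⁻¹ S
... | f , F , i | g , G , j = recPred (F *ᶜ G) λ xs → mk⇔
  (λ where
    (inj₁ Pxs) → cong (_* g xs) (to (i xs) Pxs)
    (inj₂ Qxs) → trans (cong (f xs *_) (to (j xs) Qxs)) (*-zeroʳ (f xs)))
  (λ eq → map (from (i xs)) (from (j xs)) (m*n≡0⇒m≡0∨n≡0 (f xs) eq))

rec-≤ : Computable m f → Computable m g → RecPred m (λ xs → f xs ≤ g xs)
rec-≤ F G = recPred (F ∸ᶜ G) λ xs → mk⇔ m≤n⇒m∸n≡0 (m∸n≡0⇒m≤n)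

rec-≡ : Computable m f → Computable m g → RecPred m (λ xs → f xs ≡ g xs)
rec-≡ F G = rec-resp (rec-× (rec-≤ F G) (rec-≤ G F)) λ xs →
  mk⇔ (λ (le , ge) → ≤-antisym le ge) (λ eq → ≤-reflexive eq , ≤-reflexive (sym eq))

sumBelow : (Vec ℕ (suc m) → ℕ) → ℕ → Vec ℕ m → ℕ
sumBelow f zero    xs = 0
sumBelow f (suc k) xs = sumBelow f k xs + f (k ∷ xs)

-- A finite sum of natural numbers vanishes exactly when every summand does.
rec-∀< : RecPred (suc m) P → RecPred (suc m) (λ v → ∀ i → i < head v → P (i ∷ tail v))
rec-∀< {P = P} R with recPred⁻¹ R
... | f , F , iff = recPred
  (primRec (sumBelow f) (const 0) (var #1 +ᶜ compose F (headᶜ ∷ᶜ composeMap tailᶜ tailᶜ)) (λ _ → refl) (λ _ _ → refl))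
  λ { (k ∷ xs) → mk⇔ (sum≡0 k xs) (all k xs) }
  where
  sum≡0 : ∀ k xs → (∀ i → i < k → P (i ∷ xs)) → sumBelow f k xs ≡ 0
  sum≡0 zero    xs h = refl
  sum≡0 (suc k) xs h = cong₂ _+_ (sum≡0 k xs λ i i<k → h i (m<n⇒m<1+n i<k)) (to (iff _) (h k ≤-refl))
  all : ∀ k xs → sumBelow f k xs ≡ 0 → ∀ i → i < k → P (i ∷ xs)
  all (suc k) xs eq i i<1+k with m<1+n⇒m<n∨m≡n i<1+k
  ... | inj₁ i<k  = all k xs (m+n≡0⇒m≡0 _ eq) i i<k
  ... | inj₂ refl = from (iff _) (m+n≡0⇒n≡0 (sumBelow f k xs) eq)

liftᶜ : ComputableMap n m G → ComputableMap (suc n) (suc m) (λ v → head v ∷ G (tail v))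
liftᶜ D = headᶜ ∷ᶜ composeMap D tailᶜ

swapᶜ : ComputableMap (2 + n) (2 + n) (λ v → head (tail v) ∷ head v ∷ tail (tail v))
swapᶜ = compose headᶜ tailᶜ ∷ᶜ liftᶜ tailᶜ

Σ-resp : ∀ p → SigmaP p m P → (∀ xs → P xs ⇔ Q xs) → SigmaP p m Q
Σ-resp zero    (lift R)      P⇔Q = lift (rec-resp R P⇔Q)
Σ-resp (suc p) (R , r , iff) P⇔Q = R , r , λ xs → ⇔-trans (⇔-sym (P⇔Q xs)) (iff xs)

mutual
  Σ-∘ : ∀ p → SigmaP p m P → ComputableMap n m G → SigmaP p n (P ∘ G)
  Σ-∘ zero    (lift R)      D = lift (rec-∘ R D)
  Σ-∘ {G = G} (suc p) (R , r , iff) D = (λ v → R (head v ∷ G (tail v))) , Π-∘ p r (liftᶜ D) , iff ∘ G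

  Π-∘ : ∀ p → PiP p m P → ComputableMap n m G → PiP p n (P ∘ G)
  Π-∘ zero    (lift R)      D = lift (rec-∘ R D)
  Π-∘ {G = G} (suc p) (R , r , iff) D = (λ v → R (head v ∷ G (tail v))) , Σ-∘ p r (liftᶜ D) , iff ∘ G

mutual
  rec⇒Σ : ∀ p → RecPred m P → SigmaP p m P
  rec⇒Σ zero    R = lift R
  rec⇒Σ {P = P} (suc p) R = P ∘ tail , rec⇒Π p (rec-∘ R tailᶜ) , λ xs → mk⇔ (0 ,_) proj₂

  rec⇒Π : ∀ p → RecPred m P → PiP p m P
  rec⇒Π zero    R = lift R
  rec⇒Π {P = P} (suc p) R = P ∘ tail , rec⇒Σ p (rec-∘ R tailᶜ) , λ xs → mk⇔ (λ Pxs _ → Pxs) (λ h → h 0)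

mutual
  -- Two existential witnesses are paired into one; for `Π-×` a shared universal variable suffices.
  Σ-× : ∀ p → SigmaP p m P → SigmaP p m Q → SigmaP p m (λ xs → P xs × Q xs)
  Σ-× zero    (lift R) (lift S) = lift (rec-× R S)
  Σ-× (suc p) (R , r , i) (S , s , j) =
    (λ v → R (fst (head v) ∷ tail v) × S (snd (head v) ∷ tail v)) ,
    Π-× p (Π-∘ p r (fstᶜ headᶜ ∷ᶜ tailᶜ)) (Π-∘ p s (sndᶜ headᶜ ∷ᶜ tailᶜ)) ,
    λ xs → mk⇔
      (λ (Pxs , Qxs) → let (x , Rx) = to (i xs) Pxs ; (y , Sy) = to (j xs) Qxs in
        ⟨ x , y ⟩ , subst (λ z → R (z ∷ xs)) (sym (fst-⟨⟩ x y)) Rx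
                  , subst (λ z → S (z ∷ xs)) (sym (snd-⟨⟩ x y)) Sy)
      (λ (z , Rz , Sz) → from (i xs) (fst z , Rz) , from (j xs) (snd z , Sz))

  Π-× : ∀ p → PiP p m P → PiP p m Q → PiP p m (λ xs → P xs × Q xs)
  Π-× zero    (lift R) (lift S) = lift (rec-× R S)
  Π-× (suc p) (R , r , i) (S , s , j) =
    (λ v → R v × S v) , Σ-× p r s , λ xs → mk⇔
      (λ (Pxs , Qxs) z → to (i xs) Pxs z , to (j xs) Qxs z)
      (λ h → from (i xs) (proj₁ ∘ h) , from (j xs) (proj₂ ∘ h))

Σ-∃ : ∀ p → SigmaP (suc p) (suc m) P → SigmaP (suc p) m (λ xs → ∃ λ z → P (z ∷ xs))
Σ-∃ p (R , r , iff) =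
  (λ v → R (fst (head v) ∷ snd (head v) ∷ tail v)) , Π-∘ p r (fstᶜ headᶜ ∷ᶜ sndᶜ headᶜ ∷ᶜ tailᶜ) , λ xs → mk⇔
    (λ (z , Pz) → let (w , Rw) = to (iff (z ∷ xs)) Pz in
      ⟨ w , z ⟩ , subst₂ (λ a b → R (a ∷ b ∷ xs)) (sym (fst-⟨⟩ w z)) (sym (snd-⟨⟩ w z)) Rw)
    (λ (u , Ru) → snd u , from (iff (snd u ∷ xs)) (fst u , Ru))

mutual
  -- The witnesses for all `i` below the bound are collected into one sequence code; in `Π-∀<` the
  -- two universal quantifiers simply commute.
  Σ-∀< : ∀ p → SigmaP p (suc m) P → SigmaP p (suc m) (λ v → ∀ i → i < head v → P (i ∷ tail v))
  Σ-∀< zero    (lift R) = lift (rec-∀< R)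
  Σ-∀< (suc p) (R , r , iff) =
    (λ v → ∀ i → i < head (tail v) → R (nth i (head v) ∷ i ∷ tail (tail v))) ,
    -- `Π-∀<` expects the bound as head variable, but here the head is the sequence of witnesses.
    Π-∘ p (Π-∀< p (Π-∘ p r (nthᶜ (var #0) (var #1) ∷ᶜ headᶜ ∷ᶜ composeMap tailᶜ tailᶜ))) swapᶜ ,
    λ v → mk⇔
      (λ h → let (s , eq) = finite-choice (head v) (λ i i<k → proj₁ (to (iff _) (h i i<k))) in
        s , λ i i<k → subst (λ z → R (z ∷ i ∷ tail v)) (sym (eq i i<k)) (proj₂ (to (iff _) (h i i<k))))
      (λ (s , h) i i<k → from (iff _) (nth i s , h i i<k))

  Π-∀< : ∀ p → PiP p (suc m) P → PiP p (suc m) (λ v → ∀ i → i < head v → P (i ∷ tail v))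
  Π-∀< zero    (lift R) = lift (rec-∀< R)
  Π-∀< (suc p) (R , r , iff) =
    (λ v → ∀ i → i < head (tail v) → R (head v ∷ i ∷ tail (tail v))) ,
    Σ-∘ p (Σ-∀< p (Σ-∘ p r swapᶜ)) swapᶜ ,
    λ v → mk⇔
      (λ h z i i<k → to (iff _) (h i i<k) z)
      (λ h i i<k → from (iff _) (λ z → h z i i<k))

-- Universal predicates

-- The innermost quantifier also ranges over running times; since the matrix
-- is decided by a total program, "halts with 0" and "never halts with a
-- positive value" describe it equally well.
mutual
  Σ-univ : ℕ → ℕ → ℕ → Set
  Σ-univ zero    e v = ∃ λ z → output e (cons (fst z) v) (snd z) ≡ 1
  Σ-univ (suc p) e v = ∃ λ z → Π-univ p e (cons z v)

  Π-univ : ℕ → ℕ → ℕ → Set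
  Π-univ zero    e v = ∀ z → output e (cons (fst z) v) (snd z) ≤ 1
  Π-univ (suc p) e v = ∀ z → Σ-univ p e (cons z v)

mutual
  Σ-univ-Σ : ∀ p → SigmaP (suc p) 2 (λ v → Σ-univ p (lookup v #0) (lookup v #1))
  Σ-univ-Σ zero = _ , lift (rec-≡ (outputᶜ (var #1) (consᶜ (fstᶜ (var #0)) (var #2)) (sndᶜ (var #0))) (const 1)) ,
    λ _ → mk⇔ id id
  Σ-univ-Σ (suc p) = _ , Π-∘ (suc p) (Π-univ-Π p) (var #1 ∷ᶜ consᶜ (var #0) (var #2) ∷ᶜ []ᶜ) , λ _ → mk⇔ id id

  Π-univ-Π : ∀ p → PiP (suc p) 2 (λ v → Π-univ p (lookup v #0) (lookup v #1))
  Π-univ-Π zero = _ , lift (rec-≤ (outputᶜ (var #1) (consᶜ (fstᶜ (var #0)) (var #2)) (sndᶜ (var #0))) (const 1)) ,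
    λ _ → mk⇔ id id
  Π-univ-Π (suc p) = _ , Σ-∘ (suc p) (Σ-univ-Σ p) (var #1 ∷ᶜ consᶜ (var #0) (var #2) ∷ᶜ []ᶜ) , λ _ → mk⇔ id id

halts : ∀ {c : PR (suc n)} {x xs y} → Eval c (x ∷ xs) y →
        ∃ λ z → fst z ≡ x × output ⌜ c ⌝ (cons (fst z) (code xs)) (snd z) ≡ suc y
halts {c = c} {x} {xs} {y} e with eval⇒output e
... | k , eq = ⟨ x , k ⟩ , fst-⟨⟩ x k ,
  subst₂ (λ a b → output ⌜ c ⌝ (cons a (code xs)) b ≡ suc y) (sym (fst-⟨⟩ x k)) (sym (snd-⟨⟩ x k)) eq

output-eval : ∀ {c : PR n} {xs x y} k → Eval c xs y → output ⌜ c ⌝ (code xs) k ≡ suc x → x ≡ y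
output-eval {c = c} {xs} k e eq with eval⇒output e
... | l , eq′ = output-unique ⌜ c ⌝ (code xs) k l eq eq′

mutual
  -- The index is the code of the program for the innermost matrix; each quantified variable is put
  -- in front of the argument code.
  Σ-complete : ∀ p → SigmaP (suc p) m P → ∃ λ e → ∀ xs → P xs ⇔ Σ-univ p e (code xs)
  Σ-complete zero (R , lift (c , total , i) , j) = ⌜ c ⌝ , λ xs → ⇔-trans (j xs) (mk⇔
    (λ (x , Rx) → let (z , _ , eq) = halts (to (i (x ∷ xs)) Rx) in z , eq)
    -- Output 1 means value 0. Totality supplies a derivation, and its value must agree with the
    -- output.
    (λ (z , eq) → let (y , e) = total (fst z ∷ xs) in
      fst z , from (i _) (subst (Eval c _) (sym (output-eval (snd z) e eq)) e)))
  Σ-complete (suc p) (R , r , j) with Π-complete p r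
  ... | e , i = e , λ xs → ⇔-trans (j xs) (mk⇔
    (λ (x , Rx) → x , to (i _) Rx) (λ (x , u) → x , from (i _) u))

  Π-complete : ∀ p → PiP (suc p) m P → ∃ λ e → ∀ xs → P xs ⇔ Π-univ p e (code xs)
  Π-complete zero (R , lift (c , total , i) , j) = ⌜ c ⌝ , λ xs → ⇔-trans (j xs) (mk⇔
    (λ h z → ≤1 (snd z) (to (i _) (h (fst z))))
    -- At the time when the program halts on `x`, the bound on the output forces the value 0.
    (λ h x → let (y , e) = total (x ∷ xs) ; (z , z≡ , eq) = halts e in
      from (i _) (subst (Eval c _) (n≤0⇒n≡0 (s≤s⁻¹ (subst (_≤ 1) eq (h z)))) e)))
    where
    ≤1 : ∀ {xs} k → Eval c xs 0 → output ⌜ c ⌝ (code xs) k ≤ 1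
    ≤1 {xs} k e with output ⌜ c ⌝ (code xs) k in eq
    ... | zero  = z≤n
    ... | suc x = s≤s (≤-reflexive (output-eval k e eq))
  Π-complete (suc p) (R , r , j) with Σ-complete p r
  ... | e , i = e , λ xs → ⇔-trans (j xs) (mk⇔
    (λ h x → to (i _) (h x)) (λ h x → from (i _) (h x)))

-- The complete relation

Path : (ℕ → ℕ → Set) → ℕ → ℕ → ℕ → ℕ → Set
Path T k s x y = (nth 0 s ≡ x × nth k s ≡ y) × (∀ i → i < k → T (nth i s) (nth (suc i) s))

-- Replaces the inductive closure by numerical witnesses and a bounded quantifier, which the
-- hierarchy can absorb.
star⇒path : ∀ {T x y} → Star T x y → ∃ λ k → ∃ λ s → Path T k s x y
star⇒path {x = x} ε = 0 , cons x 0 , (hd-cons x 0 , hd-cons x 0) , λ _ ()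
star⇒path {T} {x} (t ◅ ts) with star⇒path ts
... | k , s , (refl , refl) , links = suc k , cons x s , (hd-cons x s , nth-suc-cons k x s) , λ where
  zero    _         → subst₂ T (sym (hd-cons x s)) (sym (nth-suc-cons 0 x s)) t
  (suc i) (s≤s i<k) → subst₂ T (sym (nth-suc-cons i x s)) (sym (nth-suc-cons (suc i) x s)) (links i i<k)

path⇒star : ∀ {T x y} k s → Path T k s x y → Star T x y
path⇒star zero    s ((refl , refl) , _) = ε
path⇒star {T} (suc k) s ((refl , refl) , links) = links 0 (s≤s z≤n) ◅ path⇒star k (tl s)
  ( (sym (nth-suc 0 s) , sym (nth-suc k s))
  , λ i i<k → subst₂ T (nth-suc i s) (nth-suc (suc i) s) (links (suc i) (s≤s i<k)))

entry : ℕ → ℕ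
entry x = nth (fst x) (snd (snd x))

Link : ℕ → ℕ → ℕ → ℕ → Set
Link p e a b = Σ-univ p e (code (a ∷ b ∷ [])) × Σ-univ p e (code (b ∷ a ∷ []))

-- A number ⟨ i , ⟨ e , code xs ⟩ ⟩ stands for the i-th entry of xs in copy
-- ⟨ e , code xs ⟩ of the reflexive transitive closure of U ∩ U⁻¹, where U is
-- the e-th Σₚ₊₁ relation; this closure is U when U is an equivalence.
FinCopies : ℕ → ℕ → ℕ → Set
FinCopies p x y = snd x ≡ snd y × Star (Link p (fst (snd x))) (entry x) (entry y)

-- Reversing a path swaps the two halves of each link. `transport` is needed since the index is read
-- off the left point.
finCopies-isEquivalence : ∀ p → IsEquivalence (FinCopies p)
finCopies-isEquivalence p = record
  { refl  = refl , ε
  ; sym   = λ (eq , xy) → sym eq , transport eq (reverse (λ (u , v) → v , u) xy)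
  ; trans = λ (eq , xy) (eq′ , yz) → trans eq eq′ , xy ◅◅ transport (sym eq) yz
  }
  where
  transport : ∀ {w w′ a b} → w ≡ w′ → Star (Link p (fst w)) a b → Star (Link p (fst w′)) a b
  transport refl ts = ts

-- One number codes length and vertices of a path: the conditions on copy and endpoints are
-- recursive, and the links form a bounded conjunction.
finCopies-Σ : ∀ p → SigmaRel (suc p) (FinCopies p)
finCopies-Σ p = Σ-resp (suc p) (Σ-∃ p (Σ-× (suc p) (rec⇒Σ (suc p) ends) links)) λ
  { (x ∷ y ∷ []) → mk⇔
    (λ (z , (eq , start , end) , ls) → eq , path⇒star (fst z) (snd z) ((start , end) , ls))
    (λ (eq , ts) → let (k , s , π) = star⇒path ts in
      ⟨ k , s ⟩ , pack eq (subst₂ (λ k s → Path (Link p (fst (snd x))) k s (entry x) (entry y)) (sym (fst-⟨⟩ k s)) (sym (snd-⟨⟩ k s)) π)) }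
  where
  pack : ∀ {A B C D : Set} → A → (B × C) × D → (A × B × C) × D
  pack a ((b , c) , d) = (a , b , c) , d
  entryᶜ : Computable n f → Computable n (λ v → entry (f v))
  entryᶜ x = nthᶜ (fstᶜ x) (sndᶜ (sndᶜ x))
  ends = rec-× (rec-≡ (sndᶜ (var {3} #1)) (sndᶜ (var #2)))
        (rec-× (rec-≡ (nthᶜ (const 0) (sndᶜ (var #0))) (entryᶜ (var #1)))
               (rec-≡ (nthᶜ (fstᶜ (var #0)) (sndᶜ (var #0))) (entryᶜ (var #2))))
  -- The four variables are the position on the path, the path code and the two points.
  node next : Computable 4 _
  node = nthᶜ (var #0) (sndᶜ (var #1))
  next = nthᶜ (sucᶜ (var #0)) (sndᶜ (var #1))
  index : Computable 4 _
  index = fstᶜ (sndᶜ (var #2))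
  links = Σ-∘ (suc p)
    (Σ-∀< (suc p) (Σ-× (suc p)
      (Σ-∘ (suc p) (Σ-univ-Σ p) (index ∷ᶜ consᶜ node (consᶜ next (const 0)) ∷ᶜ []ᶜ))
      (Σ-∘ (suc p) (Σ-univ-Σ p) (index ∷ᶜ consᶜ next (consᶜ node (const 0)) ∷ᶜ []ᶜ))))
    (fstᶜ (var {3} #0) ∷ᶜ var #0 ∷ᶜ var #1 ∷ᶜ var #2 ∷ᶜ []ᶜ)

-- All entries go to the copy named by `e` and the tuple itself, so one program serves all lengths.
-- Since `F` is an equivalence, the closure inside this copy is `F` again.
finCopies-complete : ∀ p {F} → IsEquivalence F → SigmaRel (suc p) F → F ≤fin FinCopies p
finCopies-complete p {F} F-equiv F-Σ with Σ-complete p F-Σ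
... | e , F⇔univ = point , (proj₁ pointᶜ , λ n i xs → proj₂ pointᶜ (n ∷ i ∷ vcode xs ∷ [])) , reduces
  where
  module F = IsEquivalence F-equiv

  point : (n : ℕ) → ℕ → Vec ℕ n → ℕ
  point n i xs = ⟨ i , ⟨ e , vcode xs ⟩ ⟩

  pointᶜ : Computable 3 (λ v → ⟨ lookup v #1 , ⟨ e , lookup v #2 ⟩ ⟩)
  pointᶜ = ⟨⟩ᶜ (var #1) (⟨⟩ᶜ (const e) (var #2))

  entry-point : ∀ {n} (xs : Vec ℕ n) i → entry (point n (toℕ i) xs) ≡ lookup xs i
  entry-point xs i rewrite fst-⟨⟩ (toℕ i) ⟨ e , vcode xs ⟩ | snd-⟨⟩ (toℕ i) ⟨ e , vcode xs ⟩
    | snd-⟨⟩ e (vcode xs) | sym (code≡vcode xs) = nth-code xs i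

  snd-point : ∀ {n} (xs : Vec ℕ n) i → snd (point n i xs) ≡ ⟨ e , vcode xs ⟩
  snd-point xs i = snd-⟨⟩ i _

  index-point : ∀ {n} (xs : Vec ℕ n) i → fst (snd (point n i xs)) ≡ e
  index-point xs i = trans (cong fst (snd-point xs i)) (fst-⟨⟩ e (vcode xs))

  star⇒F : ∀ {a b} → Star (Link p e) a b → F a b
  star⇒F ε                = F.refl
  star⇒F ((u , _) ◅ us) = F.trans (from (F⇔univ (_ ∷ _ ∷ [])) u) (star⇒F us)

  F⇒star : ∀ {a b} → F a b → Star (Link p e) a b
  F⇒star ab = (to (F⇔univ (_ ∷ _ ∷ [])) ab , to (F⇔univ (_ ∷ _ ∷ [])) (F.sym ab)) ◅ ε

  reduces : ∀ n → IsNaryReduction F (FinCopies p) n (point n)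
  reduces n xs i j _ = mk⇔
    (λ ab → trans (snd-point xs (toℕ i)) (sym (snd-point xs (toℕ j))) ,
            subst id (sym star≡) (F⇒star ab))
    (λ (_ , ts) → star⇒F (subst id star≡ ts))
    where
    star≡ : Star (Link p (fst (snd (point n (toℕ i) xs)))) (entry (point n (toℕ i) xs)) (entry (point n (toℕ j) xs)) ≡
            Star (Link p e) (lookup xs i) (lookup xs j)
    star≡ rewrite index-point xs (toℕ i) | entry-point xs i | entry-point xs j = refl

-- Incompleteness under computable reducibility

-- Program `fst x` halts on `x` with a positive value; the bound is 2 because `output` is shifted by
-- one. The second component of `x` is padding, giving infinitely many diagonal points per program.
K : ℕ → Set
K x = ∃ λ k → 2 ≤ output (fst x) (cons x 0) k

K-diagonal : ∀ {c : PR 1} {j y} → Eval c (⟨ ⌜ c ⌝ , j ⟩ ∷ []) y → K ⟨ ⌜ c ⌝ , j ⟩ ⇔ 1 ≤ y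
K-diagonal {c} {j} {y} e = mk⇔ K⇒ ⇒K
  where
  x = ⟨ ⌜ c ⌝ , j ⟩
  K⇒ : K x → 1 ≤ y
  K⇒ (k , le) with output ⌜ c ⌝ (cons x 0) k in eq | subst (λ d → 2 ≤ output d (cons x 0) k) (fst-⟨⟩ ⌜ c ⌝ j) le
  ... | suc z | s≤s 1≤z = subst (1 ≤_) (output-eval k e eq) 1≤z
  ⇒K : 1 ≤ y → K x
  ⇒K 1≤y with eval⇒output e
  ... | k , eq = k , subst (λ d → 2 ≤ output d (cons x 0) k) (sym (fst-⟨⟩ ⌜ c ⌝ j))
                       (subst (2 ≤_) (sym eq) (s≤s 1≤y))

CollapseK : ℕ → ℕ → Set
CollapseK x y = x ≡ y ⊎ (K x × K y)

collapseK-isEquivalence : IsEquivalence CollapseK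
collapseK-isEquivalence = record
  { refl  = inj₁ refl
  ; sym   = λ where
      (inj₁ eq)        → inj₁ (sym eq)
      (inj₂ (Kx , Ky)) → inj₂ (Ky , Kx)
  ; trans = λ where
      (inj₁ refl)      yz               → yz
      (inj₂ xy)        (inj₁ refl)      → inj₂ xy
      (inj₂ (Kx , _)) (inj₂ (_ , Kz)) → inj₂ (Kx , Kz)
  }

-- A single existential quantifier over paired running times covers both memberships in `K`, over a
-- recursive matrix.
collapseK-Σ : ∀ p → SigmaRel (suc p) CollapseK
collapseK-Σ p = _ , rec⇒Π p matrix , λ { (x ∷ y ∷ []) → mk⇔
  (λ where
    (inj₁ eq)                      → 0 , inj₁ eq
    (inj₂ ((k , kx) , (l , ly))) → ⟨ k , l ⟩ , inj₂
      ( subst (λ n → 2 ≤ output (fst x) (cons x 0) n) (sym (fst-⟨⟩ k l)) kx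
      , subst (λ n → 2 ≤ output (fst y) (cons y 0) n) (sym (snd-⟨⟩ k l)) ly))
  (λ where
    (z , inj₁ eq)        → inj₁ eq
    (z , inj₂ (kx , ly)) → inj₂ ((fst z , kx) , (snd z , ly))) }
  where
  matrix = rec-⊎ (rec-≡ (var {3} #1) (var #2))
    (rec-× (rec-≤ (const 2) (outputᶜ (fstᶜ (var #1)) (consᶜ (var #1) (const 0)) (fstᶜ (var #0))))
           (rec-≤ (const 2) (outputᶜ (fstᶜ (var #2)) (consᶜ (var #2) (const 0)) (sndᶜ (var #0)))))

-- A reduction g would send K into a single copy, so {x ∣ g x lies in that copy}
-- is a computable superset of K.  A program for the complement of that set
-- gives infinitely many of its elements outside K, which g must keep
-- inequivalent although the copy has only finitely many classes.
collapseK-irreducible : ∀ p → ¬ (CollapseK ≤c FinCopies p)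
collapseK-irreducible p (g , gᶜ , g-reduces) = distinct (pigeonhole ≤-refl index)
  where
  -- The constant-1 program provides a definite element of `K`, which names the copy receiving all
  -- of `K`.
  a : ℕ
  a = ⟨ ⌜ proj₁ (const {1} 1) ⌝ , 0 ⟩

  a∈K : K a
  a∈K = from (K-diagonal (proj₂ (const 1) _)) ≤-refl

  decider : ∃ λ χ → Computable 1 χ × (∀ xs → snd (g (head xs)) ≡ snd (g a) ⇔ χ xs ≡ 0)
  decider = recPred⁻¹ (rec-≡ (sndᶜ gᶜ) (const (snd (g a))))

  diagonal : ∀ {χ} → Computable 1 χ → (∀ xs → snd (g (head xs)) ≡ snd (g a) ⇔ χ xs ≡ 0) →
             ∃ λ e → ∀ j → snd (g ⟨ e , j ⟩) ≡ snd (g a) × ¬ K ⟨ e , j ⟩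
  diagonal {χ} (c , ev) copy⇔ = ⌜ c ⌝ , λ j → inCopy j , ∉K j
    where
    inCopy : ∀ j → snd (g ⟨ ⌜ c ⌝ , j ⟩) ≡ snd (g a)
    -- A positive value of `χ` would put the point into `K`, and then `g` sends it to the copy of
    -- `g a` after all.
    inCopy j with χ (⟨ ⌜ c ⌝ , j ⟩ ∷ []) in eq | K-diagonal {c} {j} (ev _)
    ... | zero  | _  = from (copy⇔ _) eq
    ... | suc _ | K⇔ = proj₁ (to (g-reduces _ a) (inj₂ (from K⇔ (s≤s z≤n) , a∈K)))

    ∉K : ∀ j → ¬ K ⟨ ⌜ c ⌝ , j ⟩
    ∉K j Kx with () ← subst (1 ≤_) (to (copy⇔ _) (inCopy j)) (to (K-diagonal (ev _)) Kx)

  escape : ∃ λ e → ∀ j → snd (g ⟨ e , j ⟩) ≡ snd (g a) × ¬ K ⟨ e , j ⟩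
  escape = diagonal (proj₁ (proj₂ decider)) (proj₂ (proj₂ decider))

  x : ℕ → ℕ
  x j = ⟨ proj₁ escape , j ⟩

  x-copy : ∀ j → snd (g (x j)) ≡ snd (g a)
  x-copy j = proj₁ (proj₂ escape j)

  copy : ℕ
  copy = snd (snd (g a))

  -- Entries of the copy are at most `copy`, so they take at most `1 + copy` values, one fewer than
  -- the points considered.
  index : Fin (2 + copy) → Fin (1 + copy)
  index i = fromℕ< (s≤s (nth≤ (fst (g (x (toℕ i)))) copy))

  entry-x : ∀ j → entry (g (x j)) ≡ nth (fst (g (x j))) copy
  entry-x j = cong (λ w → nth (fst (g (x j))) (snd w)) (x-copy j)

  equivalent : ∀ i j → index i ≡ index j → FinCopies p (g (x (toℕ i))) (g (x (toℕ j)))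
  equivalent i j eq = trans (x-copy (toℕ i)) (sym (x-copy (toℕ j))) ,
    subst (Star _ _) (trans (entry-x (toℕ i)) (trans (fromℕ<-injective _ _ _ _ eq) (sym (entry-x (toℕ j))))) ε

  distinct : ¬ ∃ λ i → ∃ λ j → i Fin.< j × index i ≡ index j
  distinct (i , j , i<j , eq) = absurd (from (g-reduces (x (toℕ i)) (x (toℕ j))) (equivalent i j eq))
    where
    absurd : ¬ CollapseK (x (toℕ i)) (x (toℕ j))
    absurd (inj₁ x≡) = Fin.<⇒≢ i<j (toℕ-injective
      (trans (sym (snd-⟨⟩ _ (toℕ i))) (trans (cong snd x≡) (snd-⟨⟩ _ (toℕ j)))))
    absurd (inj₂ (Kx , _)) = proj₂ (proj₂ escape (toℕ i)) Kx

theorem4p12 : (p : ℕ) → 1 ≤ p →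
    Σ (ℕ → ℕ → Set) λ E →
    IsEquivalence E × SigmaRel p E ×
    (∀ (F : ℕ → ℕ → Set) → IsEquivalence F → SigmaRel p F → F ≤fin E) ×
    ¬ (∀ (F : ℕ → ℕ → Set) → IsEquivalence F → SigmaRel p F → F ≤c E)
theorem4p12 (suc p) _ =
  FinCopies p , finCopies-isEquivalence p , finCopies-Σ p ,
  (λ F → finCopies-complete p) ,
  λ complete → collapseK-irreducible p (complete CollapseK collapseK-isEquivalence (collapseK-Σ p))
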